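{- Let $n\ge1$. For $u=x_{F_1}^{a_1}\cdots x_{F_\ell}^{a_\ell}\in FY(\mathsf{B}_n)$ define $\phi(u)=(\alpha_1\cdots\alpha_n,f)$ by $$\alpha_i=\begin{cases} j & \text{if } i\in F_j\setminus F_{j-1}\\ 0 & \text{if } i\in[n]\setminus F_\ell\end{cases}\quad (i\in[n]),\qquad f(j)=a_j\quad (j\in[\ell]).$$ Then $\phi: FY(\mathsf{B}_n)\to \mathtt{Code}_n$ is a bijection that satisfies $\deg(u)=\mathrm{ind}(\phi(u))$ and respects the $\mathfrak{S}_n$-actions on both sets, i.e. $\phi(\sigma\cdot u)=\sigma\cdot\phi(u)$ for all $\sigma\in\mathfrak{S}_n$.
   Context: Write $[n]=\{1,\dots,n\}$. $FY(\mathsf{B}_n)$ is the set of formal monomials $x_{F_1}^{a_1}\cdots x_{F_\ell}^{a_\ell}$ with $0\le \ell\le n$, $\emptyset=F_0\subsetneq F_1\subsetneq\cdots\subsetneq F_\ell\subseteq[n]$ and $1\le a_i\le|F_i|-|F_{i-1}|-1$ for all $1\le i\le \ell$ (the case $\ell=0$ is the monomial $1$). The degree is $\deg(u)=a_1+\cdots+a_\ell$. $\mathfrak{S}_n$ acts on $FY(\mathsf{B}_n)$ by $\sigma\cdot x_{F_1}^{a_1}\cdots x_{F_\ell}^{a_\ell}=x_{\sigma(F_1)}^{a_1}\cdots x_{\sigma(F_\ell)}^{a_\ell}$. A Stembridge code of length $n$ is a pair $(\alpha,f)$ where $\alpha=\alpha_1\cdots\alpha_n$ is a sequence over $\{0,1,2,\dots\}$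 such that, with $m(\alpha)$ the maximum number appearing in $\alpha$, each $k\in\{1,\dots,m(\alpha)\}$ occurs at least twice in $\alpha$; and $f$ records a mark: for each such $k$, exactly one occurrence of $k$ that is not the first is marked, and $f(k)\ge1$ is the number of occurrences of $k$ to the left of the marked one (so $f:\{1,\dots,m(\alpha)\}\to\mathbb{Z}$ with $1\le f(k)\le(\text{number of occurrences of }k)-1$). The letter $0$ may occur any number of times. The index is $\mathrm{ind}(\alpha,f)=\sum_{k=1}^{m(\alpha)}f(k)$. $\mathtt{Code}_n$ is the set of all Stembridge codes of length $n$; $\mathfrak{S}_n$ acts on it by $\sigma\cdot(\alpha_1\cdots\alpha_n,f)=(\alpha_{\sigma^{ -1}(1)}\cdots\alpha_{\sigma^{ -1}(n)},f)$. -}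

module Defs where

open import Data.Bool as Bool using (if_then_else_)
open import Data.Fin as Fin using (Fin; zero; suc; toℕ; fromℕ; inject₁)
open import Data.Fin.Permutation using (Permutation′; _⟨$⟩ˡ_; _⟨$⟩ʳ_; inverseˡ; flip)
open import Data.Fin.Properties using (toℕ-cast)
open import Data.Fin.Subset using (Subset; inside; outside; ⊥; _∈_; _∉_; _⊂_; _─_; ∣_∣)
open import Data.Nat using (ℕ; zero; suc; _∸_; _⊔_; _≤_; _≟_)
open import Data.Nat.Properties using (+-0-commutativeMonoid; ⊔-0-commutativeMonoid)
open import Data.Product using (_,_)
open import Data.Vec using (Vec; []; _∷_; lookup; tabulate; map; count; sum; cast; foldr′)
open import Data.Vec.Properties
  using (lookup∘tabulate; tabulate-cong; lookup-map; lookup-replicate; []=⇒lookup; lookup⇒[]=)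
open import Function using (_∘_)
open import Level using (0ℓ)
open import Relation.Nullary using (does; yes; no)
open import Relation.Unary using (Pred; Decidable)
open import Relation.Binary.PropositionalEquality
  using (_≡_; refl; sym; trans; cong; cong₂; subst; subst₂; module ≡-Reasoning)
import Algebra.Properties.CommutativeMonoid.Sum as MonoidSum

private
  variable
    n ℓ : ℕ
    A : Set

-- [n] is Fin n throughout.

-- (permute σ v)ᵢ = v_{σ⁻¹(i)}.  On a subset, represented by its indicator
-- vector, this is the image σ(F), since i ∈ σ(F) iff σ⁻¹(i) ∈ F.
permute : Permutation′ n → Vec A n → Vec A n
permute σ v = tabulate (λ i → lookup v (σ ⟨$⟩ˡ i))

-- (∅ = F₀, F₁, …, F_ℓ), given (F₁, …, F_ℓ).
withF₀ : Vec (Subset n) ℓ → Vec (Subset n) (suc ℓ)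
withF₀ F = ⊥ ∷ F

-- For j : Fin ℓ, standing for the index j + 1 ∈ {1, …, ℓ}:
-- upper F j = F_{j+1} and lower F j = F_j.
upper lower : Vec (Subset n) ℓ → Fin ℓ → Subset n
upper F j = lookup (withF₀ F) (suc j)
lower F j = lookup (withF₀ F) (inject₁ j)

-- F_ℓ, which is F₀ = ∅ when ℓ = 0.
top : Vec (Subset n) ℓ → Subset n
top {ℓ = ℓ} F = lookup (withF₀ F) (fromℕ ℓ)

-- Truncated subtraction is harmless here: when |F_j| - |F_{j-1}| - 1 ≤ 0,
-- both readings leave no admissible a_j ≥ 1.
record IsFY {n ℓ : ℕ} (F : Vec (Subset n) ℓ) (a : Vec ℕ ℓ) : Set where
  field
    ℓ≤n    : ℓ ≤ n
    strict : ∀ (j : Fin ℓ) → lower F j ⊂ upper F j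
    1≤a    : ∀ (j : Fin ℓ) → 1 ≤ lookup a j
    a≤     : ∀ (j : Fin ℓ) → lookup a j ≤ ∣ upper F j ∣ ∸ ∣ lower F j ∣ ∸ 1

-- The side condition is irrelevant, so _≡_ on FY n compares (ℓ, F, a) only.
-- That is equality of formal monomials: all exponents are positive and the
-- F_j are distinct and ordered by inclusion.
record FY (n : ℕ) : Set where
  constructor mkFY
  field
    {len}  : ℕ
    F      : Vec (Subset n) len
    a      : Vec ℕ len
    .valid : IsFY F a

deg : FY n → ℕ
deg u = sum (FY.a u)

-- m(α), the largest letter of α (and 0 for the empty word).
maxLetter : Vec ℕ n → ℕ
maxLetter = foldr′ _⊔_ 0

occ : ℕ → Vec ℕ n → ℕ
occ k α = count (k ≟_) α

-- k : Fin (maxLetter α) stands for the letter k + 1 ∈ {1, …, m(α)}.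
record IsCode {n : ℕ} (α : Vec ℕ n) (f : Vec ℕ (maxLetter α)) : Set where
  field
    twice : ∀ (k : Fin (maxLetter α)) → 2 ≤ occ (suc (toℕ k)) α
    1≤f   : ∀ (k : Fin (maxLetter α)) → 1 ≤ lookup f k
    f≤    : ∀ (k : Fin (maxLetter α)) → lookup f k ≤ occ (suc (toℕ k)) α ∸ 1

-- The function f : {1, …, m(α)} → ℤ is positive, hence ℕ-valued, and is stored
-- as its vector of values so that _≡_ on Code n is equality of pairs (α, f).
record Code (n : ℕ) : Set where
  constructor mkCode
  field
    α      : Vec ℕ n
    f      : Vec ℕ (maxLetter α)
    .valid : IsCode α f

ind : Code n → ℕ
ind c = sum (Code.f c)

-- c = φ(u).
record IsPhi {n : ℕ} (u : FY n) (c : Code n) : Set where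
  open FY u using (len; F; a)
  open Code c using (α; f)
  field
    letter : ∀ (j : Fin len) (i : Fin n) → i ∈ upper F j ─ lower F j →
             lookup α i ≡ suc (toℕ j)
    zeros  : ∀ (i : Fin n) → i ∉ top F → lookup α i ≡ 0
    m≡ℓ    : maxLetter α ≡ len
    marks  : ∀ (k : Fin (maxLetter α)) → lookup f k ≡ lookup a (Fin.cast m≡ℓ k)

private
  module Σ+ = MonoidSum +-0-commutativeMonoid
  module Σ⊔ = MonoidSum ⊔-0-commutativeMonoid

  indicator : ∀ {P : Pred A 0ℓ} → Decidable P → A → ℕ
  indicator P? x = if does (P? x) then 1 else 0

  count≡sum : ∀ {P : Pred A 0ℓ} (P? : Decidable P) (v : Vec A n) →
              count P? v ≡ Σ+.sum (indicator P? ∘ lookup v)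
  count≡sum P? []      = refl
  count≡sum P? (x ∷ v) with P? x
  ... | yes _ = cong suc (count≡sum P? v)
  ... | no  _ = count≡sum P? v

  max≡sum : (v : Vec ℕ n) → maxLetter v ≡ Σ⊔.sum (lookup v)
  max≡sum []      = refl
  max≡sum (x ∷ v) = cong (x ⊔_) (max≡sum v)

count-permute : ∀ {P : Pred A 0ℓ} (P? : Decidable P) (σ : Permutation′ n) (v : Vec A n) →
                count P? (permute σ v) ≡ count P? v
count-permute {n = n} P? σ v = begin
  count P? (permute σ v)
    ≡⟨ count≡sum P? (permute σ v) ⟩
  Σ+.sum (indicator P? ∘ lookup (permute σ v))
    ≡⟨ Σ+.sum-cong-≗ {n = n} (λ i → cong (indicator P?) (lookup∘tabulate _ i)) ⟩
  Σ+.sum (λ i → indicator P? (lookup v (σ ⟨$⟩ˡ i)))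
    ≡⟨ Σ+.sum-permute (indicator P? ∘ lookup v) (flip σ) ⟨
  Σ+.sum (indicator P? ∘ lookup v)
    ≡⟨ count≡sum P? v ⟨
  count P? v ∎
  where open ≡-Reasoning

maxLetter-permute : (σ : Permutation′ n) (v : Vec ℕ n) → maxLetter (permute σ v) ≡ maxLetter v
maxLetter-permute {n} σ v = begin
  maxLetter (permute σ v)             ≡⟨ max≡sum (permute σ v) ⟩
  Σ⊔.sum (lookup (permute σ v))       ≡⟨ Σ⊔.sum-cong-≗ {n = n} (lookup∘tabulate _) ⟩
  Σ⊔.sum (λ i → lookup v (σ ⟨$⟩ˡ i))  ≡⟨ Σ⊔.sum-permute (lookup v) (flip σ) ⟨
  Σ⊔.sum (lookup v)                   ≡⟨ max≡sum v ⟨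
  maxLetter v                         ∎
  where open ≡-Reasoning

∈-permute⁺ : (σ : Permutation′ n) (p : Subset n) {i : Fin n} → σ ⟨$⟩ˡ i ∈ p → i ∈ permute σ p
∈-permute⁺ σ p {i} i∈ = lookup⇒[]= i _ (trans (lookup∘tabulate _ i) ([]=⇒lookup i∈))

∈-permute⁻ : (σ : Permutation′ n) (p : Subset n) {i : Fin n} → i ∈ permute σ p → σ ⟨$⟩ˡ i ∈ p
∈-permute⁻ σ p {i} i∈ = lookup⇒[]= _ p (trans (sym (lookup∘tabulate _ i)) ([]=⇒lookup i∈))

⊂-permute : (σ : Permutation′ n) {p q : Subset n} → p ⊂ q → permute σ p ⊂ permute σ q
⊂-permute σ {p} {q} (p⊆q , x , x∈q , x∉p) =
  (λ i∈ → ∈-permute⁺ σ q (p⊆q (∈-permute⁻ σ p i∈))) ,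
  σ ⟨$⟩ʳ x ,
  ∈-permute⁺ σ q (subst (_∈ q) (sym (inverseˡ σ)) x∈q) ,
  λ i∈ → x∉p (subst (_∈ p) (inverseˡ σ) (∈-permute⁻ σ p i∈))

permute-⊥ : (σ : Permutation′ n) → permute σ ⊥ ≡ ⊥
permute-⊥ {n} σ = trans (tabulate-cong (λ i → lookup-replicate (σ ⟨$⟩ˡ i) outside)) (const-tabulate n)
  where
  const-tabulate : ∀ m → tabulate {n = m} (λ _ → outside) ≡ ⊥
  const-tabulate zero    = refl
  const-tabulate (suc m) = cong (outside ∷_) (const-tabulate m)

withF₀-permute : (σ : Permutation′ n) (F : Vec (Subset n) ℓ) (j : Fin (suc ℓ)) →
                 lookup (withF₀ (map (permute σ) F)) j ≡ permute σ (lookup (withF₀ F) j)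
withF₀-permute σ F zero    = sym (permute-⊥ σ)
withF₀-permute σ F (suc j) = lookup-map j (permute σ) F

IsFY-permute : (σ : Permutation′ n) {F : Vec (Subset n) ℓ} {a : Vec ℕ ℓ} →
               IsFY F a → IsFY (map (permute σ) F) a
IsFY-permute σ {F} {a} v = record
  { ℓ≤n    = ℓ≤n
  ; strict = λ j → subst₂ _⊂_ (sym (withF₀-permute σ F (inject₁ j)))
                              (sym (withF₀-permute σ F (suc j)))
                              (⊂-permute σ (strict j))
  ; 1≤a    = 1≤a
  ; a≤     = λ j → subst (lookup a j ≤_)
                     (cong₂ (λ x y → x ∸ y ∸ 1) (card (suc j)) (card (inject₁ j))) (a≤ j)
  }
  where
  open IsFY v
  card : ∀ j → ∣ lookup (withF₀ F) j ∣ ≡ ∣ lookup (withF₀ (map (permute σ) F)) j ∣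
  card j = sym (trans (cong ∣_∣ (withF₀-permute σ F j))
                      (count-permute (Bool._≟ inside) σ (lookup (withF₀ F) j)))

IsCode-permute : (σ : Permutation′ n) {α : Vec ℕ n} {f : Vec ℕ (maxLetter α)} →
                 IsCode α f → IsCode (permute σ α) (cast (sym (maxLetter-permute σ α)) f)
IsCode-permute σ {α} {f} v = record
  { twice = λ k → subst (2 ≤_) (occ≡ k) (twice (back k))
  ; 1≤f   = λ k → subst (1 ≤_) (f≡ k) (1≤f (back k))
  ; f≤    = λ k → subst₂ _≤_ (f≡ k) (cong (_∸ 1) (occ≡ k)) (f≤ (back k))
  }
  where
  open IsCode v
  m≡ = maxLetter-permute σ α
  back : Fin (maxLetter (permute σ α)) → Fin (maxLetter α)
  back = Fin.cast m≡
  occ≡ : ∀ k → occ (suc (toℕ (back k))) α ≡ occ (suc (toℕ k)) (permute σ α)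
  occ≡ k = trans (cong (λ x → occ (suc x) α) (toℕ-cast m≡ k))
                 (sym (count-permute (suc (toℕ k) ≟_) σ α))
  lookup-cast′ : ∀ {p q} .(e : p ≡ q) .(e′ : q ≡ p) (w : Vec ℕ p) (k : Fin q) →
                 lookup w (Fin.cast e′ k) ≡ lookup (cast e w) k
  lookup-cast′ {suc p} e e′ (x ∷ w) zero    = refl
  lookup-cast′ {suc p} {suc q} e e′ (x ∷ w) (suc k) = lookup-cast′ _ _ w k
  f≡ : ∀ k → lookup f (back k) ≡ lookup (cast (sym m≡) f) k
  f≡ k = lookup-cast′ _ _ f k

infixr 7 _·ᵐ_ _·ᶜ_

_·ᵐ_ : Permutation′ n → FY n → FY n
σ ·ᵐ mkFY F a v = mkFY (map (permute σ) F) a (IsFY-permute σ v)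

-- cast only transports f along m(σ·α) ≡ m(α); its entries are unchanged.
_·ᶜ_ : Permutation′ n → Code n → Code n
σ ·ᶜ mkCode α f v =
  mkCode (permute σ α) (cast (sym (maxLetter-permute σ α)) f) (IsCode-permute σ v)

{-# OPTIONS --safe #-}

-- The flag is recovered from the word as F_j = {i : 1 ≤ α_i ≤ j}.  Passing from
-- F_{j-1} to F_j adds exactly the positions where j occurs, so
-- |F_j| - |F_{j-1}| is the number of occurrences of j and the bounds on a_j
-- and f(j) coincide.

module Submission where

open import Defs
open import Data.Bool using (Bool; true; false; _∧_; if_then_else_)
open import Data.Bool.Properties using (T-≡)
open import Data.Fin as Fin using (Fin; zero; suc; toℕ; fromℕ; inject₁; fromℕ<)
open import Data.Fin.Permutation using (Permutation′; _⟨$⟩ˡ_)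
open import Data.Fin.Properties
  using (toℕ-cast; toℕ-inject₁; toℕ-fromℕ; toℕ-fromℕ<)
open import Data.Fin.Subset
  using (Subset; inside; outside; ⊥; _∈_; _∉_; _⊂_; _─_; ∣_∣)
open import Data.Fin.Subset.Properties using (_⊂?_; ∣p∣≤n; p─q⊆p)
open import Data.Nat
  using (ℕ; zero; suc; _+_; _∸_; _≤_; _≤ᵇ_; _<ᵇ_; _≡ᵇ_; _≤?_; z≤n; s≤s)
open import Data.Nat.Properties
open import Data.Product using (Σ-syntax; ∃-syntax; _×_; _,_; proj₁; proj₂)
open import Data.Vec
  using (Vec; []; _∷_; lookup; tabulate; map; sum; cast; there)
open import Data.Vec.Properties
  using ( lookup∘tabulate; tabulate∘lookup; tabulate-cong; tabulate-∘; lookup-map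
        ; map-∘; map-cong; lookup-replicate; lookup-cast₁; cast-is-id; cast-trans
        ; []=⇒lookup; lookup⇒[]=)
open import Function using (_∘_; Equivalence)
open import Function.Consequences.Propositional
  using (inverseᵇ⇒bijective; strictlyInverseˡ⇒inverseˡ; strictlyInverseʳ⇒inverseʳ)
open import Function.Definitions using (Bijective)
open import Relation.Nullary using (recompute)
open import Relation.Binary.PropositionalEquality
  using (_≡_; refl; sym; trans; cong; cong₂; subst; subst₂; module ≡-Reasoning)

private
  variable
    m n ℓ : ℕ
    A : Set

-- Transport of vectors and set difference.

lookup-ext : {xs ys : Vec A n} → (∀ i → lookup xs i ≡ lookup ys i) → xs ≡ ys
lookup-ext {xs = xs} {ys} eq =
  trans (sym (tabulate∘lookup xs)) (trans (tabulate-cong eq) (tabulate∘lookup ys))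

sum-cast : (eq : m ≡ n) (xs : Vec ℕ m) → sum (cast eq xs) ≡ sum xs
sum-cast refl xs = cong sum (cast-is-id refl xs)

-- Entries that depend on the index only through `toℕ` survive a change of length; this lets the
-- flag rebuilt from a word be compared with the original one.
cast-tabulate-toℕ : (eq : m ≡ n) {g : ℕ → A} {xs : Vec A n} →
                    (∀ j → lookup xs j ≡ g (toℕ j)) →
                    cast eq (tabulate {n = m} (g ∘ toℕ)) ≡ xs
cast-tabulate-toℕ refl {xs = xs} eqs =
  trans (cast-is-id refl _) (trans (tabulate-cong (sym ∘ eqs)) (tabulate∘lookup xs))

x∈p─q⇒x∉q : (p q : Subset n) {x : Fin n} → x ∈ p ─ q → x ∉ q
x∈p─q⇒x∉q (_ ∷ p) (inside  ∷ q) (there x∈) (there x∈q) = x∈p─q⇒x∉q p q x∈ x∈q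
x∈p─q⇒x∉q (_ ∷ p) (outside ∷ q) (there x∈) (there x∈q) = x∈p─q⇒x∉q p q x∈ x∈q

-- The largest letter and occurrences.

lookup≤maxLetter : (α : Vec ℕ n) (i : Fin n) → lookup α i ≤ maxLetter α
lookup≤maxLetter (x ∷ α) zero    = m≤m⊔n x _
lookup≤maxLetter (x ∷ α) (suc i) = ≤-trans (lookup≤maxLetter α i) (m≤n⊔m x _)

maxLetter-lub : (α : Vec ℕ n) {b : ℕ} → (∀ i → lookup α i ≤ b) → maxLetter α ≤ b
maxLetter-lub []      bound = z≤n
maxLetter-lub (x ∷ α) bound = ⊔-lub (bound zero) (maxLetter-lub α (bound ∘ suc))

occ-positive : (k : ℕ) (α : Vec ℕ n) → 1 ≤ occ k α → ∃[ i ] lookup α i ≡ k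
occ-positive k (x ∷ α) pos with k ≡ᵇ x in eq
... | true  = zero , sym (≡ᵇ⇒≡ k x (Equivalence.from T-≡ eq))
... | false with i , αᵢ≡k ← occ-positive k α pos = suc i , αᵢ≡k

-- Level sets of a word.

-- The letter 0 is excluded because it marks the positions outside every set of the flag.
within : ℕ → ℕ → Bool
within k x = (0 <ᵇ x) ∧ (x ≤ᵇ k)

within⁺ : ∀ {k x} → 1 ≤ x → x ≤ k → within k x ≡ true
within⁺ {x = suc x} _ x≤k = Equivalence.to T-≡ (≤⇒≤ᵇ x≤k)

within⁻ : ∀ {k x} → within k x ≡ true → 1 ≤ x × x ≤ k
within⁻ {k} {suc x} eq = s≤s z≤n , ≤ᵇ⇒≤ (suc x) k (Equivalence.from T-≡ eq)

within-zero : ∀ x → within 0 x ≡ false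
within-zero zero    = refl
within-zero (suc x) = refl

level : Vec ℕ n → ℕ → Subset n
level α k = map (within k) α

∈-level⁺ : (α : Vec ℕ n) {k : ℕ} {i : Fin n} →
           1 ≤ lookup α i → lookup α i ≤ k → i ∈ level α k
∈-level⁺ α {k} {i} 1≤ ≤k =
  lookup⇒[]= i _ (trans (lookup-map i (within k) α) (within⁺ 1≤ ≤k))

∈-level⁻ : (α : Vec ℕ n) {k : ℕ} {i : Fin n} →
           i ∈ level α k → 1 ≤ lookup α i × lookup α i ≤ k
∈-level⁻ α {k} {i} i∈ = within⁻ (trans (sym (lookup-map i (within k) α)) ([]=⇒lookup i∈))

level-zero : (α : Vec ℕ n) → level α 0 ≡ ⊥
level-zero []      = refl
level-zero (x ∷ α) = cong₂ _∷_ (within-zero x) (level-zero α)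

-- Pointwise form of the cardinality count for a letter `y + 1`, written with the Boolean tests to
-- which `within` and `occ` reduce.
<ᵇ-suc : ∀ k y → (if y <ᵇ suc k then 1 else 0) ≡
                 (if y <ᵇ k then 1 else 0) + (if k ≡ᵇ y then 1 else 0)
<ᵇ-suc zero    zero    = refl
<ᵇ-suc zero    (suc y) = refl
<ᵇ-suc (suc k) zero    = refl
<ᵇ-suc (suc k) (suc y) = <ᵇ-suc k y

∣level-suc∣ : (α : Vec ℕ n) (k : ℕ) → ∣ level α (suc k) ∣ ≡ ∣ level α k ∣ + occ (suc k) α
∣level-suc∣ []          k = refl
∣level-suc∣ (zero  ∷ α) k = ∣level-suc∣ α k
-- The last term rules out all combinations of the three tests except those listed.
∣level-suc∣ (suc y ∷ α) k with y <ᵇ suc k | y <ᵇ k | k ≡ᵇ y | <ᵇ-suc k y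
... | true  | true  | false | _ = cong suc (∣level-suc∣ α k)
... | true  | false | true  | _ = trans (cong suc (∣level-suc∣ α k)) (sym (+-suc _ _))
... | false | false | false | _ = ∣level-suc∣ α k

occ≡∣level∣∸ : (α : Vec ℕ n) (k : ℕ) → occ (suc k) α ≡ ∣ level α (suc k) ∣ ∸ ∣ level α k ∣
occ≡∣level∣∸ α k = sym (trans (cong (_∸ ∣ level α k ∣) (∣level-suc∣ α k))
                             (m+n∸m≡n ∣ level α k ∣ _))

level-⊂ : (α : Vec ℕ n) (k : ℕ) → 1 ≤ occ (suc k) α → level α k ⊂ level α (suc k)
level-⊂ α k pos with i , αᵢ≡ ← occ-positive (suc k) α pos =
  (λ x∈ → let 1≤ , ≤k = ∈-level⁻ α x∈ in ∈-level⁺ α 1≤ (m≤n⇒m≤1+n ≤k)) ,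
  i ,
  ∈-level⁺ α (subst (1 ≤_) (sym αᵢ≡) (s≤s z≤n)) (≤-reflexive αᵢ≡) ,
  λ i∈ → 1+n≰n (subst (_≤ k) αᵢ≡ (proj₂ (∈-level⁻ α i∈)))

level-letter : (α : Vec ℕ n) {k : ℕ} {i : Fin n} →
               i ∈ level α (suc k) → i ∉ level α k → lookup α i ≡ suc k
level-letter α i∈ i∉ with 1≤ , ≤k+1 ← ∈-level⁻ α i∈ =
  ≤-antisym ≤k+1 (≰⇒> λ ≤k → i∉ (∈-level⁺ α 1≤ ≤k))

-- The first set of a flag containing a given point.

-- Renumbers a position in the tail as one in the whole vector, keeping 0 for "none".
shift : ℕ → ℕ
shift zero    = zero
shift (suc x) = suc (suc x)

-- Positions are counted from 1; the value is 0 if no entry is inside.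
firstInside : Vec Bool ℓ → ℕ
firstInside []            = 0
firstInside (inside  ∷ b) = 1
firstInside (outside ∷ b) = shift (firstInside b)

firstInside≤ : (b : Vec Bool ℓ) → firstInside b ≤ ℓ
firstInside≤ []            = z≤n
firstInside≤ (inside  ∷ b) = s≤s z≤n
firstInside≤ (outside ∷ b) with firstInside b | firstInside≤ b
... | zero  | _  = z≤n
... | suc x | le = s≤s le

within-shift : ∀ k x → within (suc k) (shift x) ≡ within k x
within-shift k zero    = refl
within-shift k (suc x) = refl

-- Once a point has entered the flag it stays. Here `x` is its membership in the set preceding `b`,
-- at the start `outside` because F₀ = ∅.
Ascending : Bool → Vec Bool ℓ → Set
Ascending x b = ∀ j → lookup (x ∷ b) (inject₁ j) ≡ inside → lookup b j ≡ inside

ascending-inside : (b : Vec Bool ℓ) → Ascending inside b →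
                   ∀ j → lookup (inside ∷ b) j ≡ inside
ascending-inside b             asc zero    = refl
ascending-inside (inside  ∷ b) asc (suc j) = ascending-inside b (asc ∘ suc) j
ascending-inside (outside ∷ b) asc (suc j) with () ← asc zero refl

-- An ascending vector is a run of `outside` followed by a run of `inside`, so the place of the
-- change determines it.
lookup-firstInside : (b : Vec Bool ℓ) → Ascending outside b →
                     ∀ j → lookup (outside ∷ b) j ≡ within (toℕ j) (firstInside b)
lookup-firstInside b             asc zero    = sym (within-zero (firstInside b))
lookup-firstInside (inside  ∷ b) asc (suc j) = ascending-inside b (asc ∘ suc) j
lookup-firstInside (outside ∷ b) asc (suc j) =
  trans (lookup-firstInside b (asc ∘ suc) j) (sym (within-shift (toℕ j) (firstInside b)))

-- For positive `x` the tests first succeed at position `x`, which exists as `x ≤ m`; for `x = 0`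
-- all fail and the default 0 is the right value.
firstInside-within : ∀ {m x} → x ≤ m →
                     firstInside (tabulate {n = m} (λ j → within (suc (toℕ j)) x)) ≡ x
firstInside-within {zero}  z≤n             = refl
firstInside-within {suc m} z≤n             = cong shift (firstInside-within {m} z≤n)
firstInside-within {suc m} (s≤s {zero}  _) = refl
firstInside-within {suc m} (s≤s {suc x} x≤m) = cong shift (firstInside-within x≤m)

-- The word of a flag.

column : Vec (Subset n) ℓ → Fin n → Vec Bool ℓ
column F i = map (λ p → lookup p i) F

lookup-column : (F : Vec (Subset n) ℓ) (i : Fin n) (j : Fin (suc ℓ)) →
                lookup (outside ∷ column F i) j ≡ lookup (lookup (withF₀ F) j) i
lookup-column F i zero    = sym (lookup-replicate i outside)
lookup-column F i (suc j) = lookup-map j _ F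

-- The least j with i ∈ F_j, or 0. On a flag this is the letter prescribed for φ, and it is computed
-- without using validity, which is irrelevant in `FY`.
word : Vec (Subset n) ℓ → Vec ℕ n
word F = tabulate (firstInside ∘ column F)

word≤ : (F : Vec (Subset n) ℓ) (i : Fin n) → lookup (word F) i ≤ ℓ
word≤ {ℓ = ℓ} F i = subst (_≤ ℓ) (sym (lookup∘tabulate _ i)) (firstInside≤ (column F i))

-- The column of the permuted flag at i is the column of the original flag at σ⁻¹(i).
word-permute : (σ : Permutation′ n) (F : Vec (Subset n) ℓ) →
               word (map (permute σ) F) ≡ permute σ (word F)
word-permute σ F = tabulate-cong λ i → begin
  firstInside (column (map (permute σ) F) i)
    ≡⟨ cong firstInside (map-∘ _ _ F) ⟨
  firstInside (map (λ p → lookup (permute σ p) i) F)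
    ≡⟨ cong firstInside (map-cong (λ p → lookup∘tabulate _ i) F) ⟩
  firstInside (column F (σ ⟨$⟩ˡ i))
    ≡⟨ lookup∘tabulate _ (σ ⟨$⟩ˡ i) ⟨
  lookup (word F) (σ ⟨$⟩ˡ i) ∎
  where open ≡-Reasoning

-- A valid flag yields a code.

module _ {F : Vec (Subset n) ℓ} {a : Vec ℕ ℓ} (v : IsFY F a) where
  open IsFY v

  -- The inclusions make every column ascending, so the letter at i decides in which F_j the point i
  -- lies.
  withF₀≡level : ∀ j → lookup (withF₀ F) j ≡ level (word F) (toℕ j)
  withF₀≡level j = lookup-ext λ i → begin
    lookup (lookup (withF₀ F) j) i           ≡⟨ lookup-column F i j ⟨
    lookup (outside ∷ column F i) j          ≡⟨ lookup-firstInside _ (ascending i) j ⟩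
    within (toℕ j) (firstInside (column F i)) ≡⟨ cong (within (toℕ j)) (lookup∘tabulate _ i) ⟨
    within (toℕ j) (lookup (word F) i)       ≡⟨ lookup-map i _ (word F) ⟨
    lookup (level (word F) (toℕ j)) i        ∎
    where
    open ≡-Reasoning
    ascending : ∀ i → Ascending outside (column F i)
    ascending i j i∈ = trans (lookup-column F i (suc j)) ([]=⇒lookup (proj₁ (strict j)
      (lookup⇒[]= i _ (trans (sym (lookup-column F i (inject₁ j))) i∈))))

  lower≡level : ∀ j → lower F j ≡ level (word F) (toℕ j)
  lower≡level j = trans (withF₀≡level (inject₁ j)) (cong (level (word F)) (toℕ-inject₁ j))

  word-letter : ∀ j {i} → i ∈ upper F j → i ∉ lower F j → lookup (word F) i ≡ suc (toℕ j)
  word-letter j i∈ i∉ = level-letter (word F)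
    (subst (_ ∈_) (withF₀≡level (suc j)) i∈)
    (i∉ ∘ subst (_ ∈_) (sym (lower≡level j)))

  word-zero : ∀ i → i ∉ top F → lookup (word F) i ≡ 0
  word-zero i i∉ = n<1⇒n≡0 (≰⇒> λ 1≤ → i∉ (subst (i ∈_) (sym (withF₀≡level (fromℕ ℓ)))
    (∈-level⁺ (word F) 1≤ (subst (lookup (word F) i ≤_) (sym (toℕ-fromℕ ℓ)) (word≤ F i)))))

  occ-word : ∀ j → occ (suc (toℕ j)) (word F) ≡ ∣ upper F j ∣ ∸ ∣ lower F j ∣
  occ-word j = trans (occ≡∣level∣∸ (word F) (toℕ j))
    (sym (cong₂ (λ p q → ∣ p ∣ ∸ ∣ q ∣) (withF₀≡level (suc j)) (lower≡level j)))

private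
  -- Strictness of the last inclusion supplies a position that carries the letter ℓ.
  last-letter : {F : Vec (Subset n) ℓ} {a : Vec ℕ ℓ} → IsFY F a → ℓ ≤ maxLetter (word F)
  last-letter {ℓ = zero}          v = z≤n
  last-letter {ℓ = suc ℓ} {F = F} v with _ , i , i∈ , i∉ ← IsFY.strict v (fromℕ ℓ) =
    subst (_≤ maxLetter (word F))
      (trans (word-letter v (fromℕ ℓ) i∈ i∉) (cong suc (toℕ-fromℕ ℓ)))
      (lookup≤maxLetter (word F) i)

maxLetter-word : {F : Vec (Subset n) ℓ} {a : Vec ℕ ℓ} → IsFY F a → maxLetter (word F) ≡ ℓ
maxLetter-word {F = F} v = ≤-antisym (maxLetter-lub (word F) (word≤ F)) (last-letter v)

IsCode-word : {F : Vec (Subset n) ℓ} {a : Vec ℕ ℓ} (v : IsFY F a) →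
              IsCode (word F) (cast (sym (maxLetter-word v)) a)
IsCode-word {F = F} {a} v = record
  -- From 1 ≤ f(k) ≤ occ ∸ 1 it follows that occ is positive, so the truncated subtraction is exact
  -- and occ ≥ 2.
  { twice = λ k → ≤-trans (s≤s (≤-trans (1≤f k) (f≤ k)))
                          (suc-∸1 (≤-trans (≤-trans (1≤f k) (f≤ k)) (m∸n≤m _ 1)))
  ; 1≤f   = 1≤f
  ; f≤    = f≤
  }
  where
  open IsFY v
  m≡ = maxLetter-word v
  suc-∸1 : ∀ {x} → 1 ≤ x → suc (x ∸ 1) ≤ x
  suc-∸1 (s≤s _) = ≤-refl
  f≡ : ∀ k → lookup a (Fin.cast m≡ k) ≡ lookup (cast (sym m≡) a) k
  f≡ k = sym (lookup-cast₁ (sym m≡) a k)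
  1≤f : ∀ k → 1 ≤ lookup (cast (sym m≡) a) k
  1≤f k = subst (1 ≤_) (f≡ k) (1≤a (Fin.cast m≡ k))
  f≤ : ∀ k → lookup (cast (sym m≡) a) k ≤ occ (suc (toℕ k)) (word F) ∸ 1
  f≤ k = subst₂ _≤_ (f≡ k)
    (cong (_∸ 1) (trans (sym (occ-word v (Fin.cast m≡ k)))
                        (cong (λ x → occ (suc x) (word F)) (toℕ-cast m≡ k))))
    (a≤ (Fin.cast m≡ k))

-- The flag of a code.

levels : (α : Vec ℕ n) → Vec (Subset n) (maxLetter α)
levels α = tabulate (λ j → level α (suc (toℕ j)))

withF₀-levels : (α : Vec ℕ n) → ∀ j → lookup (withF₀ (levels α)) j ≡ level α (toℕ j)
withF₀-levels α zero    = sym (level-zero α)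
withF₀-levels α (suc j) = lookup∘tabulate _ j

lower-levels : (α : Vec ℕ n) → ∀ j → lower (levels α) j ≡ level α (toℕ j)
lower-levels α j = trans (withF₀-levels α (inject₁ j)) (cong (level α) (toℕ-inject₁ j))

-- Each letter occurs, so every level gains at least one point. At the largest letter this bounds
-- the length of the flag by n.
k≤∣level∣ : (α : Vec ℕ n) → (∀ (k : Fin (maxLetter α)) → 1 ≤ occ (suc (toℕ k)) α) →
            ∀ k → k ≤ maxLetter α → k ≤ ∣ level α k ∣
k≤∣level∣ α pos zero    _   = z≤n
k≤∣level∣ α pos (suc k) k<m = begin
  suc k                           ≡⟨ +-comm 1 k ⟩
  k + 1                           ≤⟨ +-mono-≤ (k≤∣level∣ α pos k (<⇒≤ k<m)) occurs ⟩
  ∣ level α k ∣ + occ (suc k) α   ≡⟨ ∣level-suc∣ α k ⟨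
  ∣ level α (suc k) ∣             ∎
  where
  open ≤-Reasoning
  occurs : 1 ≤ occ (suc k) α
  occurs = subst (λ x → 1 ≤ occ (suc x) α) (toℕ-fromℕ< k<m) (pos (fromℕ< k<m))

IsFY-levels : {α : Vec ℕ n} {f : Vec ℕ (maxLetter α)} → IsCode α f → IsFY (levels α) f
IsFY-levels {n} {α} {f} v = record
  { ℓ≤n    = ≤-trans (k≤∣level∣ α once (maxLetter α) ≤-refl) (∣p∣≤n (level α (maxLetter α)))
  ; strict = λ j → subst₂ _⊂_ (sym (lower-levels α j)) (sym (withF₀-levels α (suc j)))
                     (level-⊂ α (toℕ j) (once j))
  ; 1≤a    = 1≤f
  ; a≤     = λ j → subst (λ x → lookup f j ≤ x ∸ 1)
                     (trans (occ≡∣level∣∸ α (toℕ j))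
                       (sym (cong₂ (λ p q → ∣ p ∣ ∸ ∣ q ∣)
                         (withF₀-levels α (suc j)) (lower-levels α j))))
                     (f≤ j)
  }
  where
  open IsCode v
  once : ∀ k → 1 ≤ occ (suc (toℕ k)) α
  once k = <⇒≤ (twice k)

-- The first level containing a position is the one indexed by its letter; a position with letter 0
-- lies in no level.
word-levels : (α : Vec ℕ n) → word (levels α) ≡ α
word-levels α = lookup-ext λ i → begin
  lookup (word (levels α)) i
    ≡⟨ lookup∘tabulate _ i ⟩
  firstInside (column (levels α) i)
    ≡⟨ cong firstInside (tabulate-∘ (λ p → lookup p i) (level α ∘ letter)) ⟨
  firstInside (tabulate (λ j → lookup (level α (letter j)) i))
    ≡⟨ cong firstInside (tabulate-cong λ j → lookup-map i (within (letter j)) α) ⟩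
  firstInside (tabulate (λ j → within (letter j) (lookup α i)))
    ≡⟨ firstInside-within (lookup≤maxLetter α i) ⟩
  lookup α i ∎
  where
  open ≡-Reasoning
  letter : Fin (maxLetter α) → ℕ
  letter j = suc (toℕ j)

-- The conditions in IsFY are decidable, so they can be recovered from the
-- irrelevant field of FY.
recomputeFY : {F : Vec (Subset n) ℓ} {a : Vec ℕ ℓ} → .(IsFY F a) → IsFY F a
recomputeFY v = record
  { ℓ≤n    = recompute (_ ≤? _) (IsFY.ℓ≤n v)
  ; strict = λ j → recompute (_ ⊂? _) (IsFY.strict v j)
  ; 1≤a    = λ j → recompute (_ ≤? _) (IsFY.1≤a v j)
  ; a≤     = λ j → recompute (_ ≤? _) (IsFY.a≤ v j)
  }

-- Equality of monomials and of codes.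

FY-≡ : {F : Vec (Subset n) m} {a : Vec ℕ m} {G : Vec (Subset n) ℓ} {b : Vec ℕ ℓ}
       .{v : IsFY F a} .{w : IsFY G b} (eq : m ≡ ℓ) →
       cast eq F ≡ G → cast eq a ≡ b → mkFY F a v ≡ mkFY G b w
FY-≡ {F = F} {a} refl F≡G a≡b
  with refl ← trans (sym (cast-is-id refl F)) F≡G
     | refl ← trans (sym (cast-is-id refl a)) a≡b = refl

-- The length of the mark vector depends on the word, so marks are compared after transport along
-- the equality of words.
Code-≡ : {α β : Vec ℕ n} {f : Vec ℕ (maxLetter α)} {g : Vec ℕ (maxLetter β)}
         .{v : IsCode α f} .{w : IsCode β g} (eq : α ≡ β) →
         cast (cong maxLetter eq) f ≡ g → mkCode α f v ≡ mkCode β g w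
Code-≡ {f = f} refl f≡g with refl ← trans (sym (cast-is-id refl f)) f≡g = refl

-- The bijection, its inverse and its properties.

-- `cast` takes its equation irrelevantly, so the irrelevant validity of the monomial suffices to
-- form the marks.
φ : FY n → Code n
φ (mkFY F a v) = mkCode (word F) (cast (sym (maxLetter-word v)) a) (IsCode-word v)

ψ : Code n → FY n
ψ (mkCode α f v) = mkFY (levels α) f (IsFY-levels v)

φ-IsPhi : (u : FY n) → IsPhi u (φ u)
φ-IsPhi (mkFY F a v) = record
  { letter = λ j i i∈ → word-letter v′ j (p─q⊆p (upper F j) (lower F j) i∈)
                                         (x∈p─q⇒x∉q (upper F j) (lower F j) i∈)
  ; zeros  = word-zero v′
  ; m≡ℓ    = maxLetter-word v′
  ; marks  = lookup-cast₁ _ a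
  }
  where v′ = recomputeFY v

φ∘ψ : (c : Code n) → φ (ψ c) ≡ c
φ∘ψ (mkCode α f v) = Code-≡ (word-levels α) (trans (cast-trans _ _ f) (cast-is-id _ f))

ψ∘φ : (u : FY n) → ψ (φ u) ≡ u
ψ∘φ (mkFY F a v) = FY-≡ m≡
  -- `F` starts at F₁, hence the shift by `suc` past F₀.
  (cast-tabulate-toℕ m≡ {level (word F) ∘ suc} (withF₀≡level v′ ∘ suc))
  (trans (cast-trans _ _ a) (cast-is-id _ a))
  where
  v′ = recomputeFY v
  m≡ = maxLetter-word v′

deg≡ind : (u : FY n) → deg u ≡ ind (φ u)
deg≡ind (mkFY F a v) = sym (sum-cast (sym (maxLetter-word (recomputeFY v))) a)

φ-equivariant : (σ : Permutation′ n) (u : FY n) → φ (σ ·ᵐ u) ≡ σ ·ᶜ φ u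
φ-equivariant σ (mkFY F a v) =
  -- On both sides the marks are `a` under two casts, which merge into the same single cast.
  Code-≡ (word-permute σ F) (trans (cast-trans _ _ a) (sym (cast-trans _ _ a)))

theorem3p6 : ∀ (n : ℕ) → 1 ≤ n →
    Σ[ φ ∈ (FY n → Code n) ]
    (∀ (u : FY n) → IsPhi u (φ u))
    × Bijective _≡_ _≡_ φ
    × (∀ (u : FY n) → deg u ≡ ind (φ u))
    × (∀ (σ : Permutation′ n) (u : FY n) → φ (σ ·ᵐ u) ≡ σ ·ᶜ φ u)
theorem3p6 n _ =
  φ ,
  φ-IsPhi ,
  inverseᵇ⇒bijective {f⁻¹ = ψ} ( strictlyInverseˡ⇒inverseˡ {f⁻¹ = ψ} φ φ∘ψ
                               , strictlyInverseʳ⇒inverseʳ {f⁻¹ = ψ} φ ψ∘φ) ,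
  deg≡ind ,
  φ-equivariant
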